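{- For every integer $k\ge 2$, the set $F_k$ is finite.
   Context: For $r\ge 2$, a $p$-step chain of length $r$ in $[0,1]$ is a sequence $[y_0,y_1,\dots,y_r]\subset[0,1]$ with $y_i-y_{i-1}=p$ for $i=1,\dots,r$; $y_0,y_r$ are its extreme points and the $y_i$ with $0<i<r$ are its interior points. The set $F_k\subset[0,1]$ is the set generated by the following recursive procedure (a priori possibly non-terminating). Start with $H=\{0,1\}$, where $0$ and $1$ carry the value $0$. Whenever $y_1<y_2$ are in $H$, $r\ge 2$ is an integer, $p=\frac{y_2-y_1}{r}\ge\frac1k$, and $p$ is strictly larger than the (smallest) values currently carried by $y_1$ and by $y_2$, add to $H$ all interior points $y_1+jp$ ($1\le j\le r-1$) of the $p$-step chain with extreme points $y_1,y_2$; each such interior point carries the value $p$ (the smallest such $p$, if it arises several times). Repeat as long as possible; $F_k$ is the set of all numbers so obtained. Equivalently: let $R$ be the smallest set of pairs of real numbers such that $(0,0),(1,0)\in R$ and, whenever $(y_1,q_1),(y_2,q_2)\in R$, $y_1<y_2$, $r\ge2$ is an integer, $p=\frac{y_2-y_1}{r}\ge\frac1k$ and $p>\max\{q_1,q_2\}$, then $(y_1+jp,\,p)\in R$ for $j=1,\dots,r-1$; then $F_k=\{y : (y,q)\in R \text{ for some } q\}$. For example $F_2=\{0,\frac12,1\}$ and $F_3=\{0,\frac13,\frac12,\frac23,1\}$. -}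

module Defs where

open import Data.Integer.Base using (+_)
open import Data.List.Membership.Propositional using (_∈_)
open import Data.Nat.Base as ℕ using (ℕ; NonZero)
open import Data.Product using (∃-syntax)
open import Data.Rational.Base as ℚ
  using (ℚ; 0ℚ; 1ℚ; _/_; _+_; _-_; _*_; _≤_; _<_)
open import Level using (Level; _⊔_)
open import Relation.Unary using (Pred; _≐_)

private
  variable
    a ℓ : Level

-- Finiteness in the strong constructive sense: some list has exactly the
-- elements of P as its members (repetitions are allowed).
Finite : {A : Set a} → Pred A ℓ → Set (a ⊔ ℓ)
Finite {A = A} P = ∃[ xs ] P ≐ (λ (x : A) → x ∈ xs)

-- The step p = (y₂ - y₁) / r of the chain of length r with extreme points y₁, y₂.
step : ℚ → ℚ → (r : ℕ) .{{_ : NonZero r}} → ℚ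
step y₁ y₂ r = (y₂ - y₁) * (+ 1 / r)

-- R k y q says that the point y is generated and carries the value q.  The
-- smallest set of pairs closed under the rules is rendered as an inductive
-- family.  The rules only ever produce rational numbers from 0 and 1, so the
-- smallest such set of pairs of reals lies in ℚ × ℚ and is this one.  A point
-- may carry several values; requiring the step to exceed some values carried
-- by the two extreme points is the same as exceeding their smallest ones.
data R (k : ℕ) .{{_ : NonZero k}} : ℚ → ℚ → Set where
  zero     : R k 0ℚ 0ℚ
  one      : R k 1ℚ 0ℚ
  interior : ∀ {y₁ q₁ y₂ q₂} →
             R k y₁ q₁ → R k y₂ q₂ → y₁ < y₂ →
             (r : ℕ) .{{_ : NonZero r}} → 2 ℕ.≤ r →
             + 1 / k ≤ step y₁ y₂ r →
             q₁ ℚ.⊔ q₂ < step y₁ y₂ r →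
             (j : ℕ) → 1 ℕ.≤ j → j ℕ.< r →
             R k (y₁ + (+ j / 1) * step y₁ y₂ r) (step y₁ y₂ r)

F : (k : ℕ) .{{_ : NonZero k}} → Pred ℚ _
F k y = ∃[ q ] R k y q

{-# OPTIONS --safe #-}
module Submission where

-- Add the points one at a time, always a new point whose step p is smallest
-- possible; then the values v 0 ≤ v 1 ≤ … of the added points never decrease.
-- A point y₁ + j p = y₂ - (r - j) p is reached from y₁ by adding p some number
-- of times and from y₂ by subtracting p some number of times.  Hence each y and
-- each 1 - y is, up to a multiple of 1, a sum of values, with at most k summands
-- since all values are at least 1/k.  By Dickson's lemma, applied to the indices
-- of the summands, an infinite process would have m < n such that both sums for
-- the m-th point are dominated by those for the n-th one: y_m ≤ y_n and
-- 1 - y_m ≤ 1 - y_n.  Then y_m = y_n, and the n-th point was not new.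
-- Dickson's lemma is obtained constructively, from almost-full relations.

open import Data.Empty using (⊥)
open import Data.Integer.Base as ℤ using (+_)
import Data.Integer.Properties as ℤ
open import Data.List.Base as List
  using (List; []; _∷_; _++_; cartesianProduct; filter; length; replicate; upTo)
open import Data.List.Membership.Propositional using (_∈_; _∉_)
open import Data.List.Membership.Propositional.Properties
  using ( ∈-map⁺; ∈-map⁻; ∈-filter⁺; ∈-filter⁻; ∈-upTo⁺; ∈-upTo⁻
        ; ∈-cartesianProduct⁺; ∈-cartesianProduct⁻ )
open import Data.List.Relation.Unary.All as All using (All; []; _∷_)
import Data.List.Relation.Unary.All.Properties as All
open import Data.List.Relation.Unary.Any using (here; there)
open import Data.Nat.Base as ℕ using (ℕ; zero; suc; NonZero)
import Data.Nat.Properties as ℕ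
open import Data.Product using (∃; ∃₂; _×_; _,_; proj₁; proj₂; uncurry)
open import Data.Rational.Base as ℚ
  using (ℚ; 0ℚ; 1ℚ; _/_; _+_; _-_; _*_; _≤_; _<_; toℚᵘ)
import Data.Rational.Properties as ℚ
open import Data.Rational.Solver using (module +-*-Solver)
import Data.Rational.Unnormalised.Base as ℚᵘ
import Data.Rational.Unnormalised.Properties as ℚᵘ
open import Data.Sum.Base as Sum using (_⊎_; inj₁; inj₂; [_,_]′)
open import Data.Vec.Base as Vec using (Vec; []; _∷_)
open import Data.Vec.Relation.Binary.Pointwise.Inductive using (Pointwise; []; _∷_)
open import Function.Base using (_∘_; _on_; case_of_; id)
open import Level using (Level; Lift; _⊔_)
open import Relation.Binary.Bundles using (module DecTotalOrder)
open import Relation.Binary.Core using (Rel; _⇒_)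
open import Relation.Binary.PropositionalEquality
  using (_≡_; refl; sym; trans; cong; cong₂; subst; subst₂; module ≡-Reasoning)
open import Relation.Nullary using (yes; no; ¬?; contradiction; _×-dec_)
open import Relation.Nullary.Decidable using (decidable-stable)
open import Relation.Unary using (Decidable)

import Data.List.Extrema (DecTotalOrder.totalOrder ℚ.≤-decTotalOrder) as Extrema
open import Data.List.Membership.DecPropositional ℚ._≟_ using (_∈?_)

open import Defs

open +-*-Solver using (solve; con; _:+_; _:*_; _:-_; _:=_)

-- Almost-full relations

private
  variable
    a b ℓ ℓ₁ ℓ₂ : Level

-- Inductive form of the property that every infinite sequence has a related pair, earlier element
-- first. The tree branches over the next element `x`; below it, a pair `y`, `z` also counts as good
-- when `x` is related to `y`.
data AlmostFull {X : Set a} (_~_ : Rel X ℓ) : Set (a ⊔ ℓ) where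
  now   : (∀ x y → x ~ y) → AlmostFull _~_
  later : (∀ x → AlmostFull (λ y z → y ~ z ⊎ x ~ y)) → AlmostFull _~_

module _ {X : Set a} where

  mono : {_~_ : Rel X ℓ₁} {_≈_ : Rel X ℓ₂} → _~_ ⇒ _≈_ → AlmostFull _~_ → AlmostFull _≈_
  mono f (now h)   = now λ x y → f (h x y)
  mono f (later h) = later λ x → mono (Sum.map f f) (h x)

  comap : {Y : Set b} {_~_ : Rel X ℓ} (f : Y → X) → AlmostFull _~_ → AlmostFull (_~_ on f)
  comap f (now h)   = now λ x y → h (f x) (f y)
  comap f (later h) = later λ x → comap f (h (f x))

  good-pair : {_~_ : Rel X ℓ} → AlmostFull _~_ → (f : ℕ → X) → ∃₂ λ m n → m ℕ.< n × f m ~ f n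
  good-pair (now h)   f = 0 , 1 , ℕ.z<s , h (f 0) (f 1)
  good-pair (later h) f with good-pair (h (f 0)) (f ∘ suc)
  ... | m , n , m<n , inj₁ fm~fn = suc m , suc n , ℕ.s<s m<n , fm~fn
  ... | m , n , m<n , inj₂ f0~fm = 0 , suc m , ℕ.z<s , f0~fm

private
  ⊎-distrib-× : {R : Set ℓ} {P : Set ℓ₁} {Q : Set ℓ₂} → R ⊎ P → R ⊎ Q → R ⊎ P × Q
  ⊎-distrib-× (inj₁ r) _        = inj₁ r
  ⊎-distrib-× (inj₂ p) (inj₁ r) = inj₁ r
  ⊎-distrib-× (inj₂ p) (inj₂ q) = inj₂ (p , q)

  ⊎-rotate : {U V W Z : Set ℓ} → ((U ⊎ V) ⊎ W) ⊎ Z → ((U ⊎ Z) ⊎ V) ⊎ W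
  ⊎-rotate = [ Sum.map₁ (Sum.map₁ inj₁) , inj₁ ∘ inj₁ ∘ inj₂ ]′

-- Intuitionistic Ramsey theorem: the parts P and Q that get intersected depend
-- first on none, then on one, finally on both of the arguments, and each stage
-- supplies the hypotheses of the next when a common element x is fixed.
module _ {X : Set a} where

  ∩-nullary : {A B T : Rel X ℓ} {P Q : Set ℓ} →
              AlmostFull A → (∀ {x y} → A x y → T x y ⊎ P) →
              AlmostFull B → (∀ {x y} → B x y → T x y ⊎ Q) →
              AlmostFull (λ x y → T x y ⊎ P × Q)
  ∩-nullary (now h) f b g = mono (λ {x} {y} Bxy → ⊎-distrib-× (f (h x y)) (g Bxy)) b
  ∩-nullary (later h) f b g = later λ x →
    mono [ [ inj₁ ∘ inj₁ , inj₂ ∘ inj₁ ]′ , inj₁ ∘ inj₂ ]′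
      (∩-nullary (h x) [ Sum.map₁ inj₁ ∘ f , Sum.map₁ inj₂ ∘ f ]′ b (Sum.map₁ inj₁ ∘ g))

  ∩-unary : {A B T : Rel X ℓ} {P Q : X → Set ℓ} →
            AlmostFull A → (∀ {x y} → A x y → T x y ⊎ P x) →
            AlmostFull B → (∀ {x y} → B x y → T x y ⊎ Q x) →
            AlmostFull (λ x y → T x y ⊎ P x × Q x)
  ∩-unary (now h) f b g = mono (λ {x} {y} Bxy → ⊎-distrib-× (f (h x y)) (g Bxy)) b
  ∩-unary a@(later _) f (now h) g = mono (λ {x} {y} Axy → ⊎-distrib-× (f Axy) (g (h x y))) a
  ∩-unary {T = T} {P} {Q} a@(later h) f b@(later k) g = later λ x →
    mono [ [ inj₁ , inj₂ ∘ inj₁ ]′ , inj₂ ∘ inj₂ ]′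
      -- Descending along `x` in one tree at a time leaves `P x` or `Q x`, constant in `y` and `z`,
      -- as an extra disjunct. It is kept inside `T` during the recursion, brought to the outside by
      -- `⊎-rotate`, and the two constants are then intersected.
      (∩-nullary {T = λ y z → (T y z ⊎ P y × Q y) ⊎ T x y}
        (∩-unary {T = λ y z → (T y z ⊎ T x y) ⊎ P x} (h x)
          [ Sum.map₁ (inj₁ ∘ inj₁) ∘ f , [ inj₁ ∘ inj₁ ∘ inj₂ , inj₁ ∘ inj₂ ]′ ∘ f ]′
          b (Sum.map₁ (inj₁ ∘ inj₁) ∘ g))
        ⊎-rotate
        (∩-unary {T = λ y z → (T y z ⊎ T x y) ⊎ Q x} a
          (Sum.map₁ (inj₁ ∘ inj₁) ∘ f)
          (k x)
          [ Sum.map₁ (inj₁ ∘ inj₁) ∘ g , [ inj₁ ∘ inj₁ ∘ inj₂ , inj₁ ∘ inj₂ ]′ ∘ g ]′)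
        ⊎-rotate)

  ∩-binary : {A B T P Q : Rel X ℓ} →
             AlmostFull A → (∀ {x y} → A x y → T x y ⊎ P x y) →
             AlmostFull B → (∀ {x y} → B x y → T x y ⊎ Q x y) →
             AlmostFull (λ x y → T x y ⊎ P x y × Q x y)
  ∩-binary (now h) f b g = mono (λ {x} {y} Bxy → ⊎-distrib-× (f (h x y)) (g Bxy)) b
  ∩-binary a@(later _) f (now h) g = mono (λ {x} {y} Axy → ⊎-distrib-× (f Axy) (g (h x y))) a
  ∩-binary {T = T} {P} {Q} a@(later h) f b@(later k) g = later λ x →
    mono [ [ inj₁ , inj₂ ∘ inj₁ ]′ , inj₂ ∘ inj₂ ]′
      -- The same scheme one stage up: with `x` fixed, `P x y` and `Q x y` depend on `y` alone.
      (∩-unary {T = λ y z → (T y z ⊎ P y z × Q y z) ⊎ T x y}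
        (∩-binary {T = λ y z → (T y z ⊎ T x y) ⊎ P x y} (h x)
          [ Sum.map₁ (inj₁ ∘ inj₁) ∘ f , [ inj₁ ∘ inj₁ ∘ inj₂ , inj₁ ∘ inj₂ ]′ ∘ f ]′
          b (Sum.map₁ (inj₁ ∘ inj₁) ∘ g))
        ⊎-rotate
        (∩-binary {T = λ y z → (T y z ⊎ T x y) ⊎ Q x y} a
          (Sum.map₁ (inj₁ ∘ inj₁) ∘ f)
          (k x)
          [ Sum.map₁ (inj₁ ∘ inj₁) ∘ g , [ inj₁ ∘ inj₁ ∘ inj₂ , inj₁ ∘ inj₂ ]′ ∘ g ]′)
        ⊎-rotate)

  _∩-almostFull_ : {A B : Rel X ℓ} → AlmostFull A → AlmostFull B →
                   AlmostFull (λ x y → A x y × B x y)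
  a ∩-almostFull b =
    mono [ (λ ()) , id ]′ (∩-binary {T = λ _ _ → Lift _ ⊥} a inj₂ b inj₂)

-- Induction on the first element. After `suc x`, a next element `w` above `x` is already good;
-- otherwise `w` is at most `x`, and whatever is at least `x` is at least `w`.
≤-almostFull : AlmostFull ℕ._≤_
≤-almostFull = later from
  where
  from : ∀ x → AlmostFull (λ y z → y ℕ.≤ z ⊎ x ℕ.≤ y)
  from zero    = now λ _ _ → inj₂ ℕ.z≤n
  from (suc x) = later λ w → case x ℕ.<? w of λ where
    (yes x<w) → now λ _ _ → inj₂ (inj₂ x<w)
    (no  x≮w) → mono [ inj₁ ∘ inj₁ , inj₂ ∘ inj₁ ∘ ℕ.≤-trans (ℕ.≮⇒≥ x≮w) ]′ (from x)

-- Induction on the length, intersecting the relations on heads and on tails. The level `a ⊔ ℓ` is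
-- that of `Pointwise`, since both intersected relations must share a level.
dickson : ∀ {X : Set a} {_~_ : Rel X (a ⊔ ℓ)} {n} → AlmostFull _~_ → AlmostFull (Pointwise _~_ {n} {n})
dickson {n = zero}  a = now λ { [] [] → [] }
dickson {ℓ = ℓ} {_~_ = _~_} {suc n} a =
  mono {_~_ = λ xs ys → Vec.head xs ~ Vec.head ys × Pointwise _~_ (Vec.tail xs) (Vec.tail ys)}
       (λ { {_ ∷ _} {_ ∷ _} (x~y , xs~ys) → x~y ∷ xs~ys })
       (comap Vec.head a ∩-almostFull comap Vec.tail (dickson {ℓ = ℓ} a))

-- Rational arithmetic

ι : ℕ → ℚ
ι n = + n / 1

ι-suc : ∀ n → ι (suc n) ≡ 1ℚ + ι n
ι-suc n = ℚ.toℚᵘ-injective (begin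
  toℚᵘ (ι (suc n))                      ≈⟨ ℚ.toℚᵘ-fromℚᵘ (ℚᵘ.mkℚᵘ (+ suc n) 0) ⟩
  ℚᵘ.mkℚᵘ (+ suc n) 0                   ≈⟨ ℚᵘ.*≡* (cong (λ i → (+ 1 ℤ.+ i) ℤ.* + 1) (sym (ℤ.*-identityʳ (+ n)))) ⟩
  ℚᵘ.1ℚᵘ ℚᵘ.+ ℚᵘ.mkℚᵘ (+ n) 0           ≈⟨ ℚᵘ.+-congʳ ℚᵘ.1ℚᵘ (ℚ.toℚᵘ-fromℚᵘ (ℚᵘ.mkℚᵘ (+ n) 0)) ⟨
  ℚᵘ.1ℚᵘ ℚᵘ.+ toℚᵘ (ι n)                ≈⟨ ℚ.toℚᵘ-homo-+ 1ℚ (ι n) ⟨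
  toℚᵘ (1ℚ + ι n)                       ∎)
  where open ℚᵘ.≃-Reasoning

ι-+ : ∀ m n → ι (m ℕ.+ n) ≡ ι m + ι n
ι-+ zero    n = sym (ℚ.+-identityˡ (ι n))
ι-+ (suc m) n = begin
  ι (suc (m ℕ.+ n)) ≡⟨ ι-suc (m ℕ.+ n) ⟩
  1ℚ + ι (m ℕ.+ n)  ≡⟨ cong (λ x → 1ℚ + x) (ι-+ m n) ⟩
  1ℚ + (ι m + ι n)  ≡⟨ ℚ.+-assoc 1ℚ (ι m) (ι n) ⟨
  (1ℚ + ι m) + ι n  ≡⟨ cong (_+ ι n) (ι-suc m) ⟨
  ι (suc m) + ι n   ∎
  where open ≡-Reasoning

ι-cancel-≤ : ∀ {m n} → ι m ≤ ι n → m ℕ.≤ n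
ι-cancel-≤ {m} {n} ιm≤ιn
  with ℚᵘ.*≤* m*1≤n*1 ← ℚᵘ.≤-respˡ-≃ (ℚ.toℚᵘ-fromℚᵘ (ℚᵘ.mkℚᵘ (+ m) 0))
                       (ℚᵘ.≤-respʳ-≃ (ℚ.toℚᵘ-fromℚᵘ (ℚᵘ.mkℚᵘ (+ n) 0)) (ℚ.toℚᵘ-mono-≤ ιm≤ιn))
  = ℤ.drop‿+≤+ (ℤ.*-cancelʳ-≤-pos (+ m) (+ n) (+ 1) m*1≤n*1)

ι-inverse : ∀ n .{{_ : NonZero n}} → ι n * (+ 1 / n) ≡ 1ℚ
ι-inverse n@(suc n-1) = ℚ.toℚᵘ-injective (begin
  toℚᵘ (ι n * (+ 1 / n))                 ≈⟨ ℚ.toℚᵘ-homo-* (ι n) (+ 1 / n) ⟩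
  toℚᵘ (ι n) ℚᵘ.* toℚᵘ (+ 1 / n)         ≈⟨ ℚᵘ.*-cong (ℚ.toℚᵘ-fromℚᵘ (ℚᵘ.mkℚᵘ (+ n) 0)) (ℚ.toℚᵘ-fromℚᵘ (ℚᵘ.mkℚᵘ (+ 1) n-1)) ⟩
  ℚᵘ.mkℚᵘ (+ n) 0 ℚᵘ.* ℚᵘ.mkℚᵘ (+ 1) n-1 ≈⟨ ℚᵘ.*-inverseʳ (ℚᵘ.mkℚᵘ (+ n) 0) ⟩
  ℚᵘ.1ℚᵘ                                 ∎)
  where open ℚᵘ.≃-Reasoning

-- Bounds by `k` both the number of summands in a sum of values that is at most 1 and the length of
-- a chain.
ι*1/k≤1⇒≤ : ∀ {n k} .{{_ : NonZero k}} → ι n * (+ 1 / k) ≤ 1ℚ → n ℕ.≤ k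
ι*1/k≤1⇒≤ {n} {k} n/k≤1 = ι-cancel-≤ (ℚ.*-cancelʳ-≤-pos (+ 1 / k) {{ℚ.normalize-pos 1 k}}
  (subst (ι n * (+ 1 / k) ≤_) (sym (ι-inverse k)) n/k≤1))

ι*step : ∀ y₁ y₂ r .{{_ : NonZero r}} → ι r * step y₁ y₂ r ≡ y₂ - y₁
ι*step y₁ y₂ r = begin
  ι r * ((y₂ - y₁) * (+ 1 / r)) ≡⟨ solve 3 (λ a b c → a :* (b :* c) := (a :* c) :* b) refl (ι r) (y₂ - y₁) (+ 1 / r) ⟩
  (ι r * (+ 1 / r)) * (y₂ - y₁) ≡⟨ cong (_* (y₂ - y₁)) (ι-inverse r) ⟩
  1ℚ * (y₂ - y₁)                ≡⟨ ℚ.*-identityˡ (y₂ - y₁) ⟩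
  y₂ - y₁                       ∎
  where open ≡-Reasoning

-- Serves to express 1 - y through 1 - y₂ for an interior point y.
interior-from-right : ∀ y₁ y₂ r .{{_ : NonZero r}} {j} → j ℕ.≤ r →
                      y₁ + ι j * step y₁ y₂ r + ι (r ℕ.∸ j) * step y₁ y₂ r ≡ y₂
interior-from-right y₁ y₂ r {j} j≤r = begin
  y₁ + ι j * p + ι (r ℕ.∸ j) * p   ≡⟨ solve 4 (λ a b c d → a :+ b :* d :+ c :* d := a :+ (b :+ c) :* d) refl y₁ (ι j) (ι (r ℕ.∸ j)) p ⟩
  y₁ + (ι j + ι (r ℕ.∸ j)) * p     ≡⟨ cong (λ x → y₁ + x * p) (ι-+ j (r ℕ.∸ j)) ⟨
  y₁ + ι (j ℕ.+ (r ℕ.∸ j)) * p     ≡⟨ cong (λ x → y₁ + ι x * p) (ℕ.m+[n∸m]≡n j≤r) ⟩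
  y₁ + ι r * p                     ≡⟨ cong (λ x → y₁ + x) (ι*step y₁ y₂ r) ⟩
  y₁ + (y₂ - y₁)                   ≡⟨ solve 2 (λ a b → a :+ (b :- a) := b) refl y₁ y₂ ⟩
  y₂                               ∎
  where open ≡-Reasoning
        p = step y₁ y₂ r

p≤p+q : ∀ p {q} → 0ℚ ≤ q → p ≤ p + q
p≤p+q p {q} 0≤q = subst (_≤ p + q) (ℚ.+-identityʳ p) (ℚ.+-monoʳ-≤ p 0≤q)

0≤1-p⇒p≤1 : ∀ {p} → 0ℚ ≤ 1ℚ - p → p ≤ 1ℚ
0≤1-p⇒p≤1 {p} 0≤1-p = subst (p ≤_) (solve 1 (λ p → p :+ (con 1ℚ :- p) := con 1ℚ) refl p) (p≤p+q p 0≤1-p)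

0≤p⇒1-p≤1 : ∀ {p} → 0ℚ ≤ p → 1ℚ - p ≤ 1ℚ
0≤p⇒1-p≤1 {p} 0≤p = subst (1ℚ - p ≤_) (solve 1 (λ p → con 1ℚ :- p :+ p := con 1ℚ) refl p) (p≤p+q (1ℚ - p) 0≤p)

1-p≤1-q⇒q≤p : ∀ {p q} → 1ℚ - p ≤ 1ℚ - q → q ≤ p
1-p≤1-q⇒q≤p {p} {q} h = subst₂ _≤_
  (solve 2 (λ p q → con 1ℚ :- p :+ (p :+ q :- con 1ℚ) := q) refl p q)
  (solve 2 (λ p q → con 1ℚ :- q :+ (p :+ q :- con 1ℚ) := p) refl p q)
  (ℚ.+-monoˡ-≤ (p + q - 1ℚ) h)

ι-mono-≤ : ∀ {m n} → m ℕ.≤ n → ι m ≤ ι n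
ι-mono-≤ {m} {n} m≤n = subst (ι m ≤_)
  (trans (sym (ι-+ m (n ℕ.∸ m))) (cong ι (ℕ.m+[n∸m]≡n m≤n)))
  (p≤p+q (ι m) (ℚ.nonNegative⁻¹ (ι (n ℕ.∸ m)) {{ℚ.normalize-nonNeg (n ℕ.∸ m) 1}}))

0≤ι : ∀ n → 0ℚ ≤ ι n
0≤ι n = ι-mono-≤ (ℕ.z≤n {n})

-- Nondecreasing sequences and sums of their terms.

module _ {v : ℕ → ℚ} (v-step : ∀ n → v n ≤ v (suc n)) where

  nondecreasing : ∀ {m n} → m ℕ.≤ n → v m ≤ v n
  nondecreasing m≤n = go (ℕ.≤⇒≤′ m≤n)
    where
    go : ∀ {m n} → m ℕ.≤′ n → v m ≤ v n
    go ℕ.≤′-refl       = ℚ.≤-refl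
    go (ℕ.≤′-step m≤n) = ℚ.≤-trans (go m≤n) (v-step _)

sum : (ℕ → ℚ) → List ℕ → ℚ
sum v []       = 0ℚ
sum v (i ∷ is) = v i + sum v is

sum-replicate-++ : ∀ v j i is → sum v (replicate j i ++ is) ≡ ι j * v i + sum v is
sum-replicate-++ v zero    i is = solve 2 (λ x s → s := con 0ℚ :* x :+ s) refl (v i) (sum v is)
sum-replicate-++ v (suc j) i is = begin
  v i + sum v (replicate j i ++ is)  ≡⟨ cong (λ x → v i + x) (sum-replicate-++ v j i is) ⟩
  v i + (ι j * v i + sum v is)       ≡⟨ solve 3 (λ x n s → x :+ (n :* x :+ s) := (con 1ℚ :+ n) :* x :+ s) refl (v i) (ι j) (sum v is) ⟩
  (1ℚ + ι j) * v i + sum v is        ≡⟨ cong (λ n → n * v i + sum v is) (ι-suc j) ⟨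
  ι (suc j) * v i + sum v is         ∎
  where open ≡-Reasoning

length*≤sum : ∀ {v x} is → All (λ i → x ≤ v i) is → ι (length is) * x ≤ sum v is
length*≤sum {v} {x} []       []            = ℚ.≤-reflexive (ℚ.*-zeroˡ x)
length*≤sum {v} {x} (i ∷ is) (x≤vi ∷ x≤vs) = begin
  ι (suc (length is)) * x     ≡⟨ cong (_* x) (ι-suc (length is)) ⟩
  (1ℚ + ι (length is)) * x    ≡⟨ solve 2 (λ n y → (con 1ℚ :+ n) :* y := y :+ n :* y) refl (ι (length is)) x ⟩
  x + ι (length is) * x       ≤⟨ ℚ.+-mono-≤ x≤vi (length*≤sum is x≤vs) ⟩
  v i + sum v is              ∎
  where open ℚ.≤-Reasoning

sumᵥ : (ℕ → ℚ) → ∀ {n} → Vec ℕ n → ℚ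
sumᵥ v is = sum v (Vec.toList is)

sumᵥ-mono : ∀ {v} → (∀ {i j} → i ℕ.≤ j → v i ≤ v j) →
            ∀ {n} {is js : Vec ℕ n} → Pointwise ℕ._≤_ is js → sumᵥ v is ≤ sumᵥ v js
sumᵥ-mono v-mono []            = ℚ.≤-refl
sumᵥ-mono v-mono (i≤j ∷ is≤js) = ℚ.+-mono-≤ (v-mono i≤j) (sumᵥ-mono v-mono is≤js)

-- Dickson's lemma compares vectors of one length; index 0 is a neutral filler because its value is
-- 0.
pad : ∀ {v} → v 0 ≡ 0ℚ → ∀ {n} is → length is ℕ.≤ n → ∃ λ (js : Vec ℕ n) → sumᵥ v js ≡ sum v is
pad     v0 {zero}  []       _             = [] , refl
pad {v} v0 {suc n} []       _             with js , eq ← pad v0 {n} [] ℕ.z≤n =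
  0 ∷ js , trans (cong₂ _+_ v0 eq) (ℚ.+-identityˡ 0ℚ)
pad {v} v0         (i ∷ is) (ℕ.s≤s is≤n) with js , eq ← pad v0 is is≤n =
  i ∷ js , cong (λ x → v i + x) eq

-- Points and chains

Point : Set
Point = ℚ × ℚ

∈-map-proj₁⁻ : ∀ {S : List Point} {y} → y ∈ List.map proj₁ S → ∃ λ q → (y , q) ∈ S
∈-map-proj₁⁻ y∈ with (_ , q) , z∈ , refl ← ∈-map⁻ proj₁ y∈ = q , z∈

-- ((a , b) , (s , j)) is the j-th point of the chain of length suc s from a to b.
Link : Set
Link = (Point × Point) × (ℕ × ℕ)

point : Link → Point
point (((y₁ , _) , (y₂ , _)) , (s , j)) = y₁ + ι j * step y₁ y₂ (suc s) , step y₁ y₂ (suc s)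

module _ (k : ℕ) .{{_ : NonZero k}} where

  Valid : Link → Set
  Valid (((y₁ , q₁) , (y₂ , q₂)) , (s , j)) =
    y₁ < y₂ × 2 ℕ.≤ suc s × + 1 / k ≤ step y₁ y₂ (suc s) × q₁ ℚ.⊔ q₂ < step y₁ y₂ (suc s) ×
    1 ℕ.≤ j × j ℕ.< suc s

  valid? : Decidable Valid
  valid? (((y₁ , q₁) , (y₂ , q₂)) , (s , j)) =
    y₁ ℚ.<? y₂ ×-dec 2 ℕ.≤? suc s ×-dec + 1 / k ℚ.≤? step y₁ y₂ (suc s) ×-dec
    q₁ ℚ.⊔ q₂ ℚ.<? step y₁ y₂ (suc s) ×-dec 1 ℕ.≤? j ×-dec j ℕ.<? suc s

  -- A finite search space. For points in [0,1] the bound `k` excludes no valid link: the step is at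
  -- least 1/k, so `suc s` is at most `k`, and `j` is below `suc s`.
  links : List Point → List Link
  links S = cartesianProduct (cartesianProduct S S) (cartesianProduct (upTo k) (upTo k))

  Fresh : List Point → Link → Set
  Fresh S c = proj₁ (point c) ∉ List.map proj₁ S

  Saturated : List Point → Set
  Saturated S = ∀ c → c ∈ links S → Valid c → proj₁ (point c) ∈ List.map proj₁ S

  -- The case of a fresh c makes the steps of successive additions nondecreasing;
  -- the other case keeps the recorded value of a point the smallest it can carry.
  Consistent : List Point → Set
  Consistent S = ∀ c {z} → c ∈ links S → Valid c → z ∈ S →
                 proj₁ z ≡ proj₁ (point c) ⊎ Fresh S c → proj₂ z ≤ proj₂ (point c)

  record Minimal (S : List Point) (c : Link) : Set where
    field
      valid   : Valid c
      ∈links  : c ∈ links S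
      fresh   : Fresh S c
      minimal : ∀ {d} → d ∈ links S → Valid d → Fresh S d → proj₂ (point c) ≤ proj₂ (point d)

  candidate? : ∀ S → Decidable (λ c → Valid c × Fresh S c)
  candidate? S c = valid? c ×-dec ¬? (proj₁ (point c) ∈? List.map proj₁ S)

  candidates : List Point → List Link
  candidates S = filter (candidate? S) (links S)

  saturated⊎minimal : ∀ S → Saturated S ⊎ ∃ (Minimal S)
  saturated⊎minimal S = split (candidates S) (λ c∈ → ∈-filter⁺ (candidate? S) c∈) (∈-filter⁻ (candidate? S))
    where
    -- The list is generalised together with both directions of its membership characterisation, so
    -- that these survive the case split.
    split : ∀ cs → (∀ {c} → c ∈ links S → Valid c × Fresh S c → c ∈ cs) →
            (∀ {c} → c ∈ cs → c ∈ links S × Valid c × Fresh S c) →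
            Saturated S ⊎ ∃ (Minimal S)
    split []       cand⁺ cand⁻ = inj₁ λ _ c∈ valid →
      decidable-stable (_ ∈? _) λ fresh → case cand⁺ c∈ (valid , fresh) of λ ()
    split (c ∷ cs) cand⁺ cand⁻ = inj₂ (m , record
      { valid   = proj₁ (proj₂ (cand⁻ m∈))
      ; ∈links  = proj₁ (cand⁻ m∈)
      ; fresh   = proj₂ (proj₂ (cand⁻ m∈))
      ; minimal = λ d∈ valid fresh → m≤ (cand⁺ d∈ (valid , fresh))
      })
      where
      m = Extrema.argmin (proj₂ ∘ point) c cs
      m∈ : m ∈ c ∷ cs
      m∈ = [ here , there ]′ (Extrema.argmin-sel (proj₂ ∘ point) c cs)
      m≤ : ∀ {d} → d ∈ c ∷ cs → proj₂ (point m) ≤ proj₂ (point d)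
      m≤ (here refl) = Extrema.f[argmin]≤f[⊤] {f = proj₂ ∘ point} c cs
      m≤ (there d∈)  = All.lookup (Extrema.f[argmin]≤f[xs] {f = proj₂ ∘ point} c cs) d∈

  links⁺ : ∀ {S a b s j} → a ∈ S → b ∈ S → s ℕ.< k → j ℕ.< k → ((a , b) , (s , j)) ∈ links S
  links⁺ a∈ b∈ s<k j<k =
    ∈-cartesianProduct⁺ (∈-cartesianProduct⁺ a∈ b∈) (∈-cartesianProduct⁺ (∈-upTo⁺ s<k) (∈-upTo⁺ j<k))

  links⁻ : ∀ {S a b s j} → ((a , b) , (s , j)) ∈ links S → (a ∈ S × b ∈ S) × (s ℕ.< k × j ℕ.< k)
  links⁻ {S} c∈ with ab∈ , sj∈ ← ∈-cartesianProduct⁻ (cartesianProduct S S) _ c∈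
    with s∈ , j∈ ← ∈-cartesianProduct⁻ (upTo k) (upTo k) sj∈ =
    ∈-cartesianProduct⁻ S S ab∈ , (∈-upTo⁻ s∈ , ∈-upTo⁻ j∈)

  valid⇒extremes< : ∀ {a b sj} → Valid ((a , b) , sj) →
                    proj₂ a < proj₂ (point ((a , b) , sj)) × proj₂ b < proj₂ (point ((a , b) , sj))
  valid⇒extremes< {_ , q₁} {_ , q₂} (_ , _ , _ , q₁⊔q₂<p , _) =
    ℚ.≤-<-trans (ℚ.p≤p⊔q q₁ q₂) q₁⊔q₂<p , ℚ.≤-<-trans (ℚ.p≤q⊔p q₁ q₂) q₁⊔q₂<p

  -- The fresh case of `Consistent` at work: a newly added point carries the largest value so far.
  ≤minimal : ∀ {S c z} → Consistent S → Minimal S c → z ∈ point c ∷ S → proj₂ z ≤ proj₂ (point c)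
  ≤minimal cons min (here refl) = ℚ.≤-refl
  ≤minimal cons min (there z∈)  = cons _ (Minimal.∈links min) (Minimal.valid min) z∈ (inj₂ (Minimal.fresh min))

  -- If the new point is an extreme point of the link, validity makes the step exceed its value, the
  -- largest in the list. Otherwise the link is an old one, and freshness for the longer list
  -- implies freshness for the shorter.
  consistent-∷ : ∀ {S x} → Consistent S →
                 (∀ {z} → z ∈ x ∷ S → proj₂ z ≤ proj₂ x) →
                 (∀ {d} → d ∈ links S → Valid d →
                  proj₁ x ≡ proj₁ (point d) ⊎ Fresh S d → proj₂ x ≤ proj₂ (point d)) →
                 Consistent (x ∷ S)
  consistent-∷ {S} {x} cons ≤x x≤ d@((a , b) , sj) {z} d∈ d-valid z∈ related =
    go (proj₁ (proj₁ bounds)) (proj₂ (proj₁ bounds)) z∈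
    where
    bounds = links⁻ {x ∷ S} d∈
    go : a ∈ x ∷ S → b ∈ x ∷ S → z ∈ x ∷ S → proj₂ z ≤ proj₂ (point d)
    go (here refl) _ z∈ = ℚ.≤-trans (≤x z∈) (ℚ.<⇒≤ (proj₁ (valid⇒extremes< {a} {b} {sj} d-valid)))
    go (there _) (here refl) z∈ = ℚ.≤-trans (≤x z∈) (ℚ.<⇒≤ (proj₂ (valid⇒extremes< {a} {b} {sj} d-valid)))
    go (there a∈) (there b∈) z∈ = case z∈ of λ where
        (here refl) → x≤ d∈′ d-valid (Sum.map₂ (_∘ there) related)
        (there z∈′) → cons d d∈′ d-valid z∈′ (Sum.map₂ (_∘ there) related)
      where
      d∈′ : d ∈ links S
      d∈′ = links⁺ a∈ b∈ (proj₁ (proj₂ bounds)) (proj₂ (proj₂ bounds))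

  -- A link to the same point as `c` inherits the freshness of `c`, so minimality covers both cases.
  minimal-≤ : ∀ {S c} → Minimal S c → ∀ {d} → d ∈ links S → Valid d →
              proj₁ (point c) ≡ proj₁ (point d) ⊎ Fresh S d → proj₂ (point c) ≤ proj₂ (point d)
  minimal-≤ {S} min d∈ d-valid related = Minimal.minimal min d∈ d-valid
    ([ (λ c≡d → Minimal.fresh min ∘ subst (_∈ List.map proj₁ S) (sym c≡d)) , id ]′ related)

-- The process

module Process (k : ℕ) .{{_ : NonZero k}} where

  record State : Set where
    field
      latest     : Point
      earlier    : List Point
    points : List Point
    points = latest ∷ earlier
    field
      sound      : All (uncurry (R k)) points
      consistent : Consistent k points

  open State

  initial : State
  initial = record
    { latest     = 0ℚ , 0ℚ
    ; earlier    = (1ℚ , 0ℚ) ∷ []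
    ; sound      = zero ∷ one ∷ []
    ; consistent = λ { _ _ (_ , _ , 1/k≤p , _) (here refl) _         → ℚ.≤-trans 0≤1/k 1/k≤p
                     ; _ _ (_ , _ , 1/k≤p , _) (there (here refl)) _ → ℚ.≤-trans 0≤1/k 1/k≤p }
    }
    where
    0≤1/k : 0ℚ ≤ + 1 / k
    0≤1/k = ℚ.nonNegative⁻¹ (+ 1 / k) {{ℚ.normalize-nonNeg 1 k}}

  -- A saturated state repeats forever, which makes the run a total sequence as `good-pair`
  -- requires. `add` prescribes only the points of `T`, not its proofs.
  data _⟶_ (S : State) : State → Set where
    halt : Saturated k (points S) → S ⟶ S
    add  : ∀ {T c} → Minimal k (points S) c → latest T ≡ point c → earlier T ≡ points S → S ⟶ T

  sound-link : ∀ {S c} → All (uncurry (R k)) S → c ∈ links k S → Valid k c → uncurry (R k) (point c)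
  sound-link {c = _ , s , j} all c∈ (y₁<y₂ , 2≤r , 1/k≤p , q<p , 1≤j , j<r)
    with (a∈ , b∈) , _ ← links⁻ k c∈ =
    interior (All.lookup all a∈) (All.lookup all b∈) y₁<y₂ (suc s) 2≤r 1/k≤p q<p j 1≤j j<r

  extend : ∀ S {c} → Minimal k (points S) c → State
  extend S {c} min = record
    { latest     = point c
    ; earlier    = points S
    ; sound      = sound-link (sound S) (Minimal.∈links min) (Minimal.valid min) ∷ sound S
    ; consistent = consistent-∷ k (consistent S) (≤minimal k (consistent S) min) (minimal-≤ k min)
    }

  advance : ∀ S → ∃ (S ⟶_)
  advance S = [ (λ sat → S , halt sat) , (λ { (c , min) → extend S min , add min refl refl }) ]′
              (saturated⊎minimal k (points S))

  states : ℕ → State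
  states zero    = initial
  states (suc n) = proj₁ (advance (states n))

  run : ∀ n → states n ⟶ states (suc n)
  run n = proj₂ (advance (states n))

  value : ℕ → ℚ
  value n = proj₂ (latest (states n))

  value-mono : ∀ {m n} → m ℕ.≤ n → value m ≤ value n
  value-mono = nondecreasing λ n → value-step n (run n)
    where
    value-step : ∀ n {T} → states n ⟶ T → value n ≤ proj₂ (latest T)
    value-step n (halt _)         = ℚ.≤-refl
    value-step n (add min eq _) = subst (λ z → value n ≤ proj₂ z) (sym eq)
      (≤minimal k (consistent (states n)) min (there (here refl)))

  ⟶-⊆ : ∀ {S T z} → S ⟶ T → z ∈ points S → z ∈ points T
  ⟶-⊆ (halt _) z∈     = z∈
  ⟶-⊆ (add _ _ eq) z∈ = there (subst (_ ∈_) (sym eq) z∈)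

  points-⊆ : ∀ {m n z} → m ℕ.≤ n → z ∈ points (states m) → z ∈ points (states n)
  points-⊆ m≤n = go (ℕ.≤⇒≤′ m≤n)
    where
    go : ∀ {m n z} → m ℕ.≤′ n → z ∈ points (states m) → z ∈ points (states n)
    go             ℕ.≤′-refl       z∈ = z∈
    go {n = suc n} (ℕ.≤′-step m≤n) z∈ = ⟶-⊆ (run n) (go m≤n z∈)

  -- Points as sums of values, from both sides.

  -- The multiple of 1 is there for the points 1 and 1 - 0, which are not sums of values.
  Sum : ℚ → Set
  Sum x = ∃₂ λ b is → All (λ i → + 1 / k ≤ value i) is × x ≡ ι b + sum value is

  Sum-extend : ∀ {x} i j → + 1 / k ≤ value i → Sum x → Sum (x + ι j * value i)
  Sum-extend i j 1/k≤v (b , is , all , refl) = b , replicate j i ++ is , All.++⁺ (All.replicate⁺ j 1/k≤v) all , (begin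
    ι b + sum value is + ι j * value i    ≡⟨ solve 3 (λ b s n → b :+ s :+ n := b :+ (n :+ s)) refl (ι b) (sum value is) (ι j * value i) ⟩
    ι b + (ι j * value i + sum value is)  ≡⟨ cong (λ x → ι b + x) (sum-replicate-++ value j i is) ⟨
    ι b + sum value (replicate j i ++ is) ∎)
    where open ≡-Reasoning

  TwoSided : Point → Set
  TwoSided (y , _) = Sum y × Sum (1ℚ - y)

  -- This also confines the points to [0,1], as sums of values are nonnegative.
  twoSided : ∀ n → All TwoSided (points (states n))
  twoSided zero = ((0 , [] , [] , refl) , (1 , [] , [] , refl)) ∷ ((1 , [] , [] , refl) , (0 , [] , [] , refl)) ∷ []
  twoSided (suc n) = go (run n) refl
    where
    new : ∀ c → c ∈ links k (points (states n)) → Valid k c → proj₂ (point c) ≡ value (suc n) → TwoSided (point c)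
    new (((y₁ , _) , (y₂ , _)) , s , j) c∈ (_ , _ , 1/k≤p , _ , _ , j<r) p≡v
      with (a∈ , b∈) , _ ← links⁻ k c∈ =
      -- The step of the added link is `value (suc n)`. So index `suc n` is appended `j` times to
      -- the sum for y₁, and `r ∸ j` times to the sum for 1 - y₂.
      subst (λ p → Sum (y₁ + ι j * p)) (sym p≡v) (Sum-extend (suc n) j 1/k≤v (proj₁ (All.lookup (twoSided n) a∈))) ,
      subst Sum (trans (cong (λ p → 1ℚ - y₂ + ι (r ℕ.∸ j) * p) (sym p≡v)) from-right)
        (Sum-extend (suc n) (r ℕ.∸ j) 1/k≤v (proj₂ (All.lookup (twoSided n) b∈)))
      where
      r = suc s
      p = step y₁ y₂ r
      1/k≤v = subst (+ 1 / k ≤_) p≡v 1/k≤p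
      from-right : 1ℚ - y₂ + ι (r ℕ.∸ j) * p ≡ 1ℚ - (y₁ + ι j * p)
      from-right = begin
        1ℚ - y₂ + ι (r ℕ.∸ j) * p
          ≡⟨ cong (λ y → 1ℚ - y + ι (r ℕ.∸ j) * p) (interior-from-right y₁ y₂ r (ℕ.<⇒≤ j<r)) ⟨
        1ℚ - (y₁ + ι j * p + ι (r ℕ.∸ j) * p) + ι (r ℕ.∸ j) * p
          ≡⟨ solve 2 (λ y m → con 1ℚ :- (y :+ m) :+ m := con 1ℚ :- y) refl (y₁ + ι j * p) (ι (r ℕ.∸ j) * p) ⟩
        1ℚ - (y₁ + ι j * p) ∎
        where open ≡-Reasoning
    go : ∀ {T} → states n ⟶ T → proj₂ (latest T) ≡ value (suc n) → All TwoSided (points T)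
    go (halt _) _ = twoSided n
    go (add {c = c} min refl refl) p≡v = new c (Minimal.∈links min) (Minimal.valid min) p≡v ∷ twoSided n

  -- Bounds, codes of fixed length, and termination.

  0≤sum : ∀ {is} → All (λ i → + 1 / k ≤ value i) is → 0ℚ ≤ sum value is
  0≤sum {is} all = ℚ.≤-trans
    (ℚ.nonNegative⁻¹ (ι (length is) * (+ 1 / k))
      {{ℚ.nonNeg*nonNeg⇒nonNeg (ι (length is)) {{ℚ.normalize-nonNeg (length is) 1}}
                               (+ 1 / k) {{ℚ.normalize-nonNeg 1 k}}}})
    (length*≤sum is all)

  Sum-nonNegative : ∀ {x} → Sum x → 0ℚ ≤ x
  Sum-nonNegative (b , is , all , refl) = ℚ.≤-trans (0≤ι b) (p≤p+q (ι b) (0≤sum all))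

  -- One slot holds the multiple of 1, the other `k` hold indices of summands. Both kinds of entry
  -- contribute monotonically, so codes can be compared entry by entry.
  total : Vec ℕ (suc k) → ℚ
  total (b ∷ is) = ι b + sumᵥ value is

  total-mono : ∀ {u v} → Pointwise ℕ._≤_ u v → total u ≤ total v
  total-mono (b≤c ∷ is≤js) = ℚ.+-mono-≤ (ι-mono-≤ b≤c) (sumᵥ-mono value-mono is≤js)

  encode : ∀ {x} → Sum x → x ≤ 1ℚ → ∃ λ u → total u ≡ x
  encode (b , is , all , refl) x≤1 =
    b ∷ proj₁ padded , cong (λ x → ι b + x) (proj₂ padded)
    where
    sum≤1 : sum value is ≤ 1ℚ
    sum≤1 = ℚ.≤-trans (subst (sum value is ≤_) (ℚ.+-comm (sum value is) (ι b)) (p≤p+q (sum value is) (0≤ι b))) x≤1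
    padded : ∃ λ (js : Vec ℕ k) → sumᵥ value js ≡ sum value is
    -- `refl` proves that `value 0` is 0: the run starts with the point 0, carrying 0, as its latest
    -- point.
    padded = pad {v = value} refl is (ι*1/k≤1⇒≤ (ℚ.≤-trans (length*≤sum is all) sum≤1))

  latestTwoSided : ∀ n → TwoSided (latest (states n))
  latestTwoSided n = All.lookup (twoSided n) (here refl)

  leftCode : ∀ n → ∃ λ u → total u ≡ proj₁ (latest (states n))
  leftCode n = encode (proj₁ (latestTwoSided n)) (0≤1-p⇒p≤1 (Sum-nonNegative (proj₂ (latestTwoSided n))))

  rightCode : ∀ n → ∃ λ u → total u ≡ 1ℚ - proj₁ (latest (states n))
  rightCode n = encode (proj₂ (latestTwoSided n)) (0≤p⇒1-p≤1 (Sum-nonNegative (proj₁ (latestTwoSided n))))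

  codes : ℕ → Vec ℕ (suc k) × Vec ℕ (suc k)
  codes n = proj₁ (leftCode n) , proj₁ (rightCode n)

  _≼_ : Rel (Vec ℕ (suc k) × Vec ℕ (suc k)) _
  (u , w) ≼ (u′ , w′) = Pointwise ℕ._≤_ u u′ × Pointwise ℕ._≤_ w w′

  ≼-almostFull : AlmostFull _≼_
  ≼-almostFull = comap proj₁ (dickson ≤-almostFull) ∩-almostFull comap proj₂ (dickson ≤-almostFull)

  codes-≼⇒≡ : ∀ {m n} → codes m ≼ codes n → proj₁ (latest (states m)) ≡ proj₁ (latest (states n))
  codes-≼⇒≡ {m} {n} (left , right) = ℚ.≤-antisym
    (subst₂ _≤_ (proj₂ (leftCode m)) (proj₂ (leftCode n)) (total-mono left))
    (1-p≤1-q⇒q≤p (subst₂ _≤_ (proj₂ (rightCode m)) (proj₂ (rightCode n)) (total-mono right)))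

  -- Transition `n` leads to stage `suc n`. The point of stage `m` is still listed at stage `n`, so
  -- this transition cannot have added it as fresh and must be `halt`.
  repeats⇒saturated : ∀ {m n} → m ℕ.≤ n → proj₁ (latest (states m)) ≡ proj₁ (latest (states (suc n))) →
                      Saturated k (points (states n))
  repeats⇒saturated {m} {n} m≤n eq = go (run n)
    (subst (_∈ List.map proj₁ (points (states n))) eq (∈-map⁺ proj₁ (points-⊆ m≤n (here refl))))
    where
    go : ∀ {S T} → S ⟶ T → proj₁ (latest T) ∈ List.map proj₁ (points S) → Saturated k (points S)
    go (halt sat)       _  = sat
    go (add min refl _) y∈ = contradiction y∈ (Minimal.fresh min)

  halts : ∃ λ n → Saturated k (points (states n))
  halts = go (good-pair ≼-almostFull codes)
    where
    go : (∃₂ λ m n → m ℕ.< n × codes m ≼ codes n) → ∃ λ n → Saturated k (points (states n))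
    go (m , suc n , ℕ.s≤s m≤n , m≼n) = n , repeats⇒saturated m≤n (codes-≼⇒≡ {m} {suc n} m≼n)

  -- Completeness of the final list.

  length≤k : ∀ {n} (a b : Point) {s j} → a ∈ points (states n) → b ∈ points (states n) →
             Valid k ((a , b) , s , j) → suc s ℕ.≤ k
  length≤k {n} (y₁ , _) (y₂ , _) {s} a∈ b∈ (_ , _ , 1/k≤p , _) = ι*1/k≤1⇒≤ (begin
    ι (suc s) * (+ 1 / k)            ≤⟨ ℚ.*-monoˡ-≤-nonNeg (ι (suc s)) {{ℚ.normalize-nonNeg (suc s) 1}} 1/k≤p ⟩
    ι (suc s) * step y₁ y₂ (suc s)   ≡⟨ ι*step y₁ y₂ (suc s) ⟩
    -- By `twoSided`, y₂ is at most 1 and y₁ at least 0.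
    y₂ - y₁                          ≤⟨ ℚ.+-mono-≤ (0≤1-p⇒p≤1 {y₂} (Sum-nonNegative (proj₂ (All.lookup (twoSided n) b∈))))
                                                   (ℚ.neg-antimono-≤ (Sum-nonNegative (proj₁ (All.lookup (twoSided n) a∈)))) ⟩
    1ℚ - 0ℚ                          ≡⟨⟩
    1ℚ                               ∎)
    where open ℚ.≤-Reasoning

  -- Induction on the derivation. Replacing the values of the extreme points by smaller recorded
  -- ones keeps the link valid, saturation supplies the interior point, and the same-point case of
  -- `Consistent` bounds its recorded value, which the induction needs.
  complete : ∀ {n} → Saturated k (points (states n)) → ∀ {y q} → R k y q →
             ∃ λ q′ → (y , q′) ∈ points (states n) × q′ ≤ q
  complete {n} sat zero = 0ℚ , points-⊆ {0} {n} ℕ.z≤n (here refl) , ℚ.≤-refl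
  complete {n} sat one  = 0ℚ , points-⊆ {0} {n} ℕ.z≤n (there (here refl)) , ℚ.≤-refl
  complete {n} sat (interior {y₁} {q₁} {y₂} {q₂} R₁ R₂ y₁<y₂ r@(suc s) 2≤r 1/k≤p q<p j 1≤j j<r)
    with q₁′ , a∈ , q₁′≤q₁ ← complete {n} sat R₁ | q₂′ , b∈ , q₂′≤q₂ ← complete {n} sat R₂ =
    found (∈-map-proj₁⁻ (sat c c∈ valid))
    where
    c : Link
    c = ((y₁ , q₁′) , (y₂ , q₂′)) , s , j
    valid : Valid k c
    valid = y₁<y₂ , 2≤r , 1/k≤p , ℚ.≤-<-trans (ℚ.⊔-mono-≤ q₁′≤q₁ q₂′≤q₂) q<p , 1≤j , j<r
    r≤k = length≤k {n} (y₁ , q₁′) (y₂ , q₂′) a∈ b∈ valid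
    c∈ : c ∈ links k (points (states n))
    c∈ = links⁺ k a∈ b∈ r≤k (ℕ.<-≤-trans j<r r≤k)
    found : (∃ λ q′ → (proj₁ (point c) , q′) ∈ points (states n)) →
            ∃ λ q′ → (proj₁ (point c) , q′) ∈ points (states n) × q′ ≤ proj₂ (point c)
    found (q′ , z∈) = q′ , z∈ , consistent (states n) c c∈ valid z∈ (inj₁ refl)

  F-finite : Finite (F k)
  F-finite = go halts
    where
    go : (∃ λ n → Saturated k (points (states n))) → Finite (F k)
    go (n , sat) = List.map proj₁ (points (states n)) , ⊆ , ⊇
      where
      ⊆ : ∀ {y} → F k y → y ∈ List.map proj₁ (points (states n))
      ⊆ (q , Ryq) with q′ , z∈ , _ ← complete {n} sat Ryq = ∈-map⁺ proj₁ z∈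
      ⊇ : ∀ {y} → y ∈ List.map proj₁ (points (states n)) → F k y
      ⊇ y∈ with q , z∈ ← ∈-map-proj₁⁻ y∈ = q , All.lookup (sound (states n)) z∈

theorem4p3 : (k : ℕ) .{{_ : NonZero k}} → 2 ℕ.≤ k → Finite (F k)
theorem4p3 k _ = Process.F-finite k
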